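{- Consider the Normal Partizan Domination game on the star $K_{1,n}$ ($n\geq 1$) in which every vertex has color $C$. Its value is $*$ if $n$ is odd and $*2$ if $n$ is even.
   Context: Normal Partizan Domination game: a finite graph $G$ has each vertex colored $A$, $B$ or $C$. Alice and Bob alternately select a vertex; Alice may only select vertices colored $A$ or $C$, Bob only vertices colored $B$ or $C$. A vertex $u$ dominates $v$ if $u=v$ or $uv$ is an edge. A vertex may be selected only if it is playable, i.e. it dominates at least one vertex not dominated by the previously selected vertices; the game ends when the selected vertices form a dominating set. Under normal play the player unable to move loses. The game is regarded as a partizan combinatorial game with Alice as Left and Bob as Right, and its value is its value in Conway's combinatorial game theory ($\{X\mid Y\}$ has Left options $X$ and Right options $Y$; $G=H$ iff $G+(-H)$ is a second-player win). Nimbers: $*=\{0\mid 0\}$, $*2=\{0,*\mid 0,*\}$. -}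

module Defs where

open import Data.Empty using (⊥)
open import Data.Fin.Base using (Fin; zero; suc)
open import Data.Fin.Subset using (Subset; _∈_; _∪_; ⁅_⁆; _⊃_) renaming (⊥ to ∅)
open import Data.Fin.Subset.Induction using (⊃-wellFounded; Acc; acc)
open import Data.Fin.Subset.Properties using (x∈⁅x⁆; p⊆p∪q; q⊆p∪q)
open import Data.List.Base using (List; []; _∷_; length; lookup)
open import Data.Nat.Base using (ℕ; suc)
open import Data.Product.Base using (Σ; ∃; _×_; _,_)
open import Data.Sum.Base using (_⊎_; inj₁; inj₂; [_,_]′)
open import Data.Unit.Base using (⊤)
open import Level using (0ℓ)
open import Relation.Binary.Core using (Rel)
open import Relation.Binary.Definitions using (Symmetric; Irreflexive)
open import Relation.Binary.PropositionalEquality using (_≡_; refl)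
open import Relation.Nullary.Negation using (¬_)

------------------------------------------------------------------------
-- Conway games under normal play

-- Options are indexed families; an option may be repeated.
data Game : Set₁ where
  game : (L R : Set) → (L → Game) → (R → Game) → Game

infix 8 -_
infixl 6 _+_
infix 4 _≈_

-_ : Game → Game
- game L R l r = game R L (λ j → - r j) (λ i → - l i)

_+_ : Game → Game → Game
G@(game L R l r) + H@(game L′ R′ l′ r′) =
  game (L ⊎ L′) (R ⊎ R′)
       [ (λ i → l i + H) , (λ i → G + l′ i) ]′
       [ (λ j → r j + H) , (λ j → G + r′ j) ]′

mutual
  LeftWinsMovingFirst : Game → Set
  LeftWinsMovingFirst (game L _ l _) = Σ L λ i → LeftWinsMovingSecond (l i)

  LeftWinsMovingSecond : Game → Set
  LeftWinsMovingSecond (game _ R _ r) = (j : R) → LeftWinsMovingFirst (r j)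

mutual
  RightWinsMovingFirst : Game → Set
  RightWinsMovingFirst (game _ R _ r) = Σ R λ j → RightWinsMovingSecond (r j)

  RightWinsMovingSecond : Game → Set
  RightWinsMovingSecond (game L _ l _) = (i : L) → RightWinsMovingFirst (l i)

SecondPlayerWin : Game → Set
SecondPlayerWin G = LeftWinsMovingSecond G × RightWinsMovingSecond G

-- Equality of values.
_≈_ : Rel Game 0ℓ
G ≈ H = SecondPlayerWin (G + - H)

⟨_∣_⟩ : List Game → List Game → Game
⟨ xs ∣ ys ⟩ = game (Fin (length xs)) (Fin (length ys)) (lookup xs) (lookup ys)

𝟎 ∗ ∗2 : Game
𝟎  = ⟨ [] ∣ [] ⟩
∗  = ⟨ 𝟎 ∷ [] ∣ 𝟎 ∷ [] ⟩
∗2 = ⟨ 𝟎 ∷ ∗ ∷ [] ∣ 𝟎 ∷ ∗ ∷ [] ⟩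

------------------------------------------------------------------------
-- Finite simple graphs

record Graph (n : ℕ) : Set₁ where
  infix 4 _~_
  field
    _~_    : Rel (Fin n) 0ℓ
    sym    : Symmetric _~_
    irrefl : Irreflexive _≡_ _~_

-- Adjacency of K₁,ₙ: the centre is zero and the n leaves are suc i.
data StarAdjacent {n : ℕ} : Rel (Fin (suc n)) 0ℓ where
  centre~leaf : ∀ {i} → StarAdjacent zero (suc i)
  leaf~centre : ∀ {i} → StarAdjacent (suc i) zero

star : ∀ n → Graph (suc n)
star n = record
  { _~_    = StarAdjacent
  ; sym    = λ { centre~leaf → leaf~centre ; leaf~centre → centre~leaf }
  ; irrefl = λ { refl () }
  }

------------------------------------------------------------------------
-- Normal Partizan Domination

data Player : Set where
  alice bob : Player

data Colour : Set where
  A B C : Colour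

_MaySelect_ : Player → Colour → Set
alice MaySelect A = ⊤
alice MaySelect B = ⊥
alice MaySelect C = ⊤
bob   MaySelect A = ⊥
bob   MaySelect B = ⊤
bob   MaySelect C = ⊤

module _ {n : ℕ} (G : Graph n) where
  open Graph G

  Dominates : Rel (Fin n) 0ℓ
  Dominates u v = u ≡ v ⊎ u ~ v

  DominatedBy : Subset n → Fin n → Set
  DominatedBy S v = ∃ λ w → w ∈ S × Dominates w v

  -- S is the set of previously selected vertices.
  Playable : Subset n → Fin n → Set
  Playable S u = ∃ λ v → Dominates u v × ¬ DominatedBy S v

  select-grows : ∀ {S u} → Playable S u → (S ∪ ⁅ u ⁆) ⊃ S
  select-grows {S} {u} (v , u-dom-v , v-undom) =
    p⊆p∪q ⁅ u ⁆ , u , q⊆p∪q S ⁅ u ⁆ (x∈⁅x⁆ u) , λ u∈S → v-undom (u , u∈S , u-dom-v)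

  module _ (colour : Fin n → Colour) where

    Move : Player → Subset n → Set
    Move p S = Σ (Fin n) λ u → p MaySelect colour u × Playable S u

    -- Left is Alice and Right is Bob. Once S dominates G no vertex is
    -- playable, so the end of the game needs no separate clause.
    position : (S : Subset n) → Acc _⊃_ S → Game
    position S (acc rs) =
      game (Move alice S) (Move bob S)
           (λ { (u , _ , playable) → position (S ∪ ⁅ u ⁆) (rs (select-grows playable)) })
           (λ { (u , _ , playable) → position (S ∪ ⁅ u ⁆) (rs (select-grows playable)) })

    normalPartizanDomination : Game
    normalPartizanDomination = position ∅ (⊃-wellFounded ∅)

{-# OPTIONS --safe #-}
module Submission where

open import Defs
open import Data.Nat.Base using (ℕ; _≥_)
open import Data.Nat.Divisibility using (_∣_)
open import Data.Product.Base using (_×_)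
open import Relation.Nullary.Negation using (¬_)

open import Data.Fin.Base using (zero; suc)
open import Data.Fin.Subset using (Subset; _∉_; _∪_; ⁅_⁆; _⊃_; ∁; ∣_∣; inside; outside) renaming (⊥ to ∅)
open import Data.Fin.Subset.Induction using (⊃-wellFounded; Acc; acc)
open import Data.Fin.Subset.Properties using (∣⊥∣≡0; ∣∁p∣≡n∸∣p∣; ∪-identityʳ)
open import Data.List.Base using ([]; _∷_; lookup)
open import Data.Nat.Base using (zero; suc; _<_; _∸_; z≤n; s≤s)
open import Data.Nat.Divisibility using (_∣0; ∣-refl; ∣m∣n⇒∣m+n; ∣m+n∣m⇒∣n; ∣1⇒≡1)
open import Data.Nat.Properties using (<-cmp)
open import Data.Product.Base using (∃; _,_; proj₁; proj₂)
open import Data.Sum.Base using (_⊎_; inj₁; inj₂)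
open import Data.Unit.Base using (tt)
open import Data.Vec.Base using (_∷_; here; there)
open import Function.Base using (_∘_)
open import Relation.Binary.Definitions using (tri<; tri≈; tri>)
open import Relation.Binary.PropositionalEquality using (_≡_; _≢_; refl; sym; trans; cong; subst)
open import Relation.Nullary.Negation using (contradiction)

-- With all vertices coloured C the game is impartial, so its value is a nimber
-- computed by mex. Selecting the centre ends the game; until then, a position
-- with m unselected leaves moves to 0 or to a position with m − 1 of them, so
-- the nimbers for m = 0, 1, 2, 3, 4, … are 0, 1, 2, 1, 2, ….

-- P i j reads: option i has nimber j.
Mex : {I : Set} → (I → ℕ → Set) → ℕ → Set
Mex P k = (∀ i → ∃ λ j → j ≢ k × P i j) × (∀ {j} → j < k → ∃ λ i → P i j)

-- A relation rather than a function, since options are indexed by arbitrary types over which no mex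
-- can be computed.
HasNimber : Game → ℕ → Set
HasNimber (game L R l r) k =
  Mex (λ i → HasNimber (l i)) k × Mex (λ j → HasNimber (r j)) k

neg-nimber : ∀ G {k} → HasNimber G k → HasNimber (- G) k
neg-nimber (game L R l r) ((avoidˡ , reachˡ) , (avoidʳ , reachʳ)) =
  ( (λ i → let j , j≢k , h = avoidʳ i in j , j≢k , neg-nimber (r i) h)
  , (λ j<k → let i , h = reachʳ j<k in i , neg-nimber (r i) h) ) ,
  ( (λ i → let j , j≢k , h = avoidˡ i in j , j≢k , neg-nimber (l i) h)
  , (λ j<k → let i , h = reachˡ j<k in i , neg-nimber (l i) h) )

≢⇒<⊎> : ∀ {a b} → a ≢ b → a < b ⊎ b < a
≢⇒<⊎> {a} {b} a≢b with <-cmp a b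
... | tri< a<b _ _ = inj₁ a<b
... | tri≈ _ a≡b _ = contradiction a≡b a≢b
... | tri> _ _ b<a = inj₂ b<a

mutual
  -- Two-heap Nim: the mover brings the larger nimber down to the smaller one, which some option
  -- attains because it lies below the mex.
  left-first : ∀ G H {a b} → HasNimber G a → HasNimber H b → a < b ⊎ b < a →
               LeftWinsMovingFirst (G + H)
  left-first G@(game _ _ _ _) H@(game _ _ l′ _) g h (inj₁ a<b) =
    let i , hᵢ = proj₂ (proj₁ h) a<b in inj₂ i , left-second G (l′ i) g hᵢ
  left-first G@(game _ _ l _) H@(game _ _ _ _) g h (inj₂ b<a) =
    let i , gᵢ = proj₂ (proj₁ g) b<a in inj₁ i , left-second (l i) H gᵢ h

  -- Any move of Right changes exactly one of the two equal nimbers, up or down, so Left can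
  -- equalise them again.
  left-second : ∀ G H {a} → HasNimber G a → HasNimber H a → LeftWinsMovingSecond (G + H)
  left-second G@(game _ _ _ r) H@(game _ _ _ _) g h (inj₁ i) =
    let _ , j≢a , gᵢ = proj₁ (proj₂ g) i in left-first (r i) H gᵢ h (≢⇒<⊎> j≢a)
  left-second G@(game _ _ _ _) H@(game _ _ _ r′) g h (inj₂ i) =
    let _ , j≢a , hᵢ = proj₁ (proj₂ h) i in left-first G (r′ i) g hᵢ (≢⇒<⊎> (j≢a ∘ sym))

mutual
  right-first : ∀ G H {a b} → HasNimber G a → HasNimber H b → a < b ⊎ b < a →
                RightWinsMovingFirst (G + H)
  right-first G@(game _ _ _ _) H@(game _ _ _ r′) g h (inj₁ a<b) =
    let i , hᵢ = proj₂ (proj₂ h) a<b in inj₂ i , right-second G (r′ i) g hᵢ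
  right-first G@(game _ _ _ r) H@(game _ _ _ _) g h (inj₂ b<a) =
    let i , gᵢ = proj₂ (proj₂ g) b<a in inj₁ i , right-second (r i) H gᵢ h

  right-second : ∀ G H {a} → HasNimber G a → HasNimber H a → RightWinsMovingSecond (G + H)
  right-second G@(game _ _ l _) H@(game _ _ _ _) g h (inj₁ i) =
    let _ , j≢a , gᵢ = proj₁ (proj₁ g) i in right-first (l i) H gᵢ h (≢⇒<⊎> j≢a)
  right-second G@(game _ _ _ _) H@(game _ _ l′ _) g h (inj₂ i) =
    let _ , j≢a , hᵢ = proj₁ (proj₁ h) i in right-first G (l′ i) g hᵢ (≢⇒<⊎> (j≢a ∘ sym))

-- Nimbers are their own negatives, so `G + - H` is a Nim position with two equal heaps.
nimber-≈ : ∀ G H {k} → HasNimber G k → HasNimber H k → G ≈ H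
nimber-≈ G H g h = left-second G (- H) g -h , right-second G (- H) g -h
  where -h = neg-nimber H h

𝟎-nimber : HasNimber 𝟎 0
𝟎-nimber = ((λ ()) , (λ ())) , ((λ ()) , (λ ()))

∗-nimber : HasNimber ∗ 1
∗-nimber = mex , mex
  where
  mex : Mex (λ i → HasNimber (lookup (𝟎 ∷ []) i)) 1
  mex = (λ { zero → 0 , (λ ()) , 𝟎-nimber })
      , (λ { (s≤s z≤n) → zero , 𝟎-nimber })

∗2-nimber : HasNimber ∗2 2
∗2-nimber = mex , mex
  where
  mex : Mex (λ i → HasNimber (lookup (𝟎 ∷ ∗ ∷ []) i)) 2
  mex = (λ { zero → 0 , (λ ()) , 𝟎-nimber ; (suc zero) → 1 , (λ ()) , ∗-nimber })
      , (λ { (s≤s z≤n) → zero , 𝟎-nimber ; (s≤s (s≤s z≤n)) → suc zero , ∗-nimber })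

-- ν (suc m) = mex {0 , ν m}.
ν : ℕ → ℕ
ν 0 = 0
ν 1 = 1
ν 2 = 2
ν (suc (suc (suc m))) = ν (suc m)

-- With the next two lemmas this verifies the mex: neither 0 nor `ν m` equals `ν (suc m)`, and
-- nothing else lies below it.
0≢ν-suc : ∀ m → 0 ≢ ν (suc m)
0≢ν-suc 0 ()
0≢ν-suc 1 ()
0≢ν-suc (suc (suc m)) = 0≢ν-suc m

ν≢ν-suc : ∀ m → ν m ≢ ν (suc m)
ν≢ν-suc 0 ()
ν≢ν-suc 1 ()
ν≢ν-suc 2 ()
ν≢ν-suc (suc (suc (suc m))) = ν≢ν-suc (suc m)

<ν-suc : ∀ m {j} → j < ν (suc m) → j ≡ 0 ⊎ j ≡ ν m
<ν-suc 0 (s≤s z≤n) = inj₁ refl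
<ν-suc 1 (s≤s z≤n) = inj₁ refl
<ν-suc 1 (s≤s (s≤s z≤n)) = inj₂ refl
<ν-suc 2 (s≤s z≤n) = inj₁ refl
<ν-suc (suc (suc (suc m))) j< = <ν-suc (suc m) j<

ν-odd : ∀ n → ¬ (2 ∣ n) → ν n ≡ 1
ν-odd 0 2∤n = contradiction (2 ∣0) 2∤n
ν-odd 1 2∤n = refl
ν-odd 2 2∤n = contradiction ∣-refl 2∤n
ν-odd (suc (suc (suc m))) 2∤n = ν-odd (suc m) λ 2∣m → 2∤n (∣m∣n⇒∣m+n ∣-refl 2∣m)

-- Stated at a successor because `ν 0` is 0; the period 2 of `ν` starts at 1.
ν-even : ∀ n → 2 ∣ suc n → ν (suc n) ≡ 2
ν-even 0 2∣1 = contradiction (∣1⇒≡1 2∣1) λ ()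
ν-even 1 _ = refl
ν-even (suc (suc m)) 2∣n = ν-even m (∣m+n∣m⇒∣n 2∣n ∣-refl)

∣∁∣-insert : ∀ {n} (T : Subset n) {i} → i ∉ T → ∣ ∁ T ∣ ≡ suc ∣ ∁ (T ∪ ⁅ i ⁆) ∣
∣∁∣-insert (inside ∷ T) {zero} i∉T = contradiction here i∉T
-- The tail of `⁅ zero ⁆` is `∅`, which leaves `T ∪ ∅` to simplify.
∣∁∣-insert (outside ∷ T) {zero} _ = cong (λ U → suc ∣ ∁ U ∣) (sym (∪-identityʳ T))
∣∁∣-insert (inside ∷ T) {suc i} i∉T = ∣∁∣-insert T (i∉T ∘ there)
∣∁∣-insert (outside ∷ T) {suc i} i∉T = cong suc (∣∁∣-insert T (i∉T ∘ there))

∣∁∣≡suc⇒∃∉ : ∀ {n} (T : Subset n) {m} → ∣ ∁ T ∣ ≡ suc m → ∃ λ i → i ∉ T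
∣∁∣≡suc⇒∃∉ (outside ∷ T) _ = zero , λ ()
∣∁∣≡suc⇒∃∉ (inside ∷ T) eq = let i , i∉T = ∣∁∣≡suc⇒∃∉ T eq in suc i , λ { (there i∈T) → i∉T i∈T }

module _ {n : ℕ} where

  Star : Graph (suc n)
  Star = star n

  pos : (S : Subset (suc n)) → Acc _⊃_ S → Game
  pos = position Star (λ _ → C)

  -- What `HasNimber` unfolds to for the moves of `p`; keeping `p` a parameter lets one mex argument
  -- serve both players.
  Option : (p : Player) {S : Subset (suc n)} → (∀ {U} → U ⊃ S → Acc _⊃_ U) →
           Move Star (λ _ → C) p S → ℕ → Set
  Option p {S} rs (u , _ , playable) =
    HasNimber (pos (S ∪ ⁅ u ⁆) (rs (select-grows Star playable)))

  centre-dominates : ∀ {T : Subset n} v → DominatedBy Star (inside ∷ T) v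
  centre-dominates zero    = zero , here , inj₁ refl
  centre-dominates (suc i) = zero , here , inj₂ centre~leaf

  -- Everything is dominated, so no move is left, and the mex of no options is 0.
  centre-nimber : ∀ {T : Subset n} (a : Acc _⊃_ (inside ∷ T)) → HasNimber (pos (inside ∷ T) a) 0
  centre-nimber {T} (acc rs) = mex alice , mex bob
    where
    mex : ∀ p → Mex (Option p rs) 0
    mex p = (λ { (_ , _ , v , _ , undom) → contradiction (centre-dominates v) undom }) , λ ()

  leaf-undominated : ∀ {T : Subset n} {i} → i ∉ T → ¬ DominatedBy Star (outside ∷ T) (suc i)
  leaf-undominated i∉T (suc _ , there i∈T , inj₁ refl) = i∉T i∈T

  -- A selected leaf already dominates all it can: itself and the centre.
  leaf-playable⇒∉ : ∀ {T : Subset n} {i} → Playable Star (outside ∷ T) (suc i) → i ∉ T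
  leaf-playable⇒∉ (_ , inj₁ refl        , undom) i∈T = undom (_ , there i∈T , inj₁ refl)
  leaf-playable⇒∉ (_ , inj₂ leaf~centre , undom) i∈T = undom (_ , there i∈T , inj₂ leaf~centre)

centre-playable⇒∃∉ : ∀ {n} {T : Subset (suc n)} →
                     Playable (star (suc n)) (outside ∷ T) zero → ∃ λ i → i ∉ T
-- If the centre is undominated, no leaf is selected, so any leaf will do; one exists because the
-- star has `suc n` leaves.
centre-playable⇒∃∉ (zero , _ , undom) = zero , λ i∈T → undom (_ , there i∈T , inj₂ leaf~centre)
centre-playable⇒∃∉ (suc i , _ , undom) = i , λ i∈T → undom (_ , there i∈T , inj₁ refl)

leaves-nimber : ∀ {n} (T : Subset (suc n)) (a : Acc _⊃_ (outside ∷ T)) →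
                HasNimber (position (star (suc n)) (λ _ → C) (outside ∷ T) a) (ν ∣ ∁ T ∣)
leaves-nimber {n} T (acc rs) = mex alice tt , mex bob tt
  where
  mex : ∀ p → p MaySelect C → Mex (Option p rs) (ν ∣ ∁ T ∣)
  mex p allowed = avoid , reach (∣ ∁ T ∣) refl
    where
    avoid : ∀ mv → ∃ λ j → j ≢ ν ∣ ∁ T ∣ × Option p rs mv j
    avoid (zero , _ , playable) =
      let i , i∉T = centre-playable⇒∃∉ playable in
      -- Leaf `i` is not played here; it only shows that the count of unselected leaves is positive,
      -- so its `ν` is not 0.
      0 , subst (λ m → 0 ≢ ν m) (sym (∣∁∣-insert T i∉T)) (0≢ν-suc ∣ ∁ (T ∪ ⁅ i ⁆) ∣) , centre-nimber _
    avoid (suc i , _ , playable) =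
      ν ∣ ∁ (T ∪ ⁅ i ⁆) ∣
      , subst (λ m → ν ∣ ∁ (T ∪ ⁅ i ⁆) ∣ ≢ ν m)
              (sym (∣∁∣-insert T (leaf-playable⇒∉ playable)))
              (ν≢ν-suc ∣ ∁ (T ∪ ⁅ i ⁆) ∣)
      , leaves-nimber (T ∪ ⁅ i ⁆) _

    reach : ∀ m → ∣ ∁ T ∣ ≡ m → ∀ {j} → j < ν ∣ ∁ T ∣ → ∃ λ mv → Option p rs mv j
    reach zero    eq j< with () ← subst (λ m → _ < ν m) eq j<
    reach (suc m) eq j< with ∣∁∣≡suc⇒∃∉ T eq
    ... | i , i∉T with <ν-suc ∣ ∁ (T ∪ ⁅ i ⁆) ∣ (subst (λ m → _ < ν m) (∣∁∣-insert T i∉T) j<)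
    -- The same unselected leaf `i` serves twice: as the vertex newly dominated by the centre, and
    -- below as the leaf to select.
    ... | inj₁ refl = (zero , allowed , suc i , inj₂ centre~leaf , leaf-undominated i∉T) , centre-nimber _
    ... | inj₂ refl = (suc i , allowed , suc i , inj₁ refl , leaf-undominated i∉T) , leaves-nimber (T ∪ ⁅ i ⁆) _

star-nimber : ∀ n → HasNimber (normalPartizanDomination (star (suc n)) (λ _ → C)) (ν (suc n))
star-nimber n =
  subst (λ m → HasNimber G (ν m))
        -- Initially all `suc n` leaves are unselected.
        (trans (∣∁p∣≡n∸∣p∣ (∅ {suc n})) (cong (suc n ∸_) (∣⊥∣≡0 (suc n))))
        (leaves-nimber ∅ (⊃-wellFounded ∅))
  where G = normalPartizanDomination (star (suc n)) (λ _ → C)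

theorem5 : (n : ℕ) → n ≥ 1 →
    (¬ (2 ∣ n) → normalPartizanDomination (star n) (λ _ → C) ≈ ∗) ×
    (2 ∣ n → normalPartizanDomination (star n) (λ _ → C) ≈ ∗2)
theorem5 (suc n) _ =
  (λ 2∤n → nimber-≈ G ∗  (subst (HasNimber G) (ν-odd (suc n) 2∤n) (star-nimber n)) ∗-nimber) ,
  (λ 2∣n → nimber-≈ G ∗2 (subst (HasNimber G) (ν-even n 2∣n) (star-nimber n)) ∗2-nimber)
  where G = normalPartizanDomination (star (suc n)) (λ _ → C)
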